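{- There exists a function $f:\mathbb{N}\to\mathbb{N}$ such that every Frobenius scheme $(\Omega,S)$ of valency $k$ and rank at least $f(k)$ is determined up to isomorphism by its intersection number array; that is, every scheme algebraically isomorphic to $(\Omega,S)$ is isomorphic to $(\Omega,S)$.
   Context: A scheme on a finite set $\Omega$ is a pair $(\Omega,S)$ where $S$ is a partition of $\Omega\times\Omega$ containing the diagonal $1_\Omega$, closed under transposition, and such that for $r,s,t\in S$ the intersection number $c_{rs}^t=|\{\beta:(\alpha,\beta)\in r,(\beta,\gamma)\in s\}|$ does not depend on $(\alpha,\gamma)\in t$. Its rank is $|S|$. An algebraic isomorphism from $(\Omega,S)$ to $(\Omega',S')$ is a bijection $\varphi:S\to S'$ with $c_{rs}^t=c_{\varphi(r)\varphi(s)}^{\varphi(t)}$ for all $r,s,t$; an isomorphism is a bijection $\Omega\to\Omega'$ mapping each basis relation of $S$ onto a basis relation of $S'$. For a transitive permutation group, its scheme has as basis relations its orbits on $\Omega\times\Omega$. A Frobenius group is a non-regular transitive permutation group with all two-point stabilizers trivial; a Frobenius scheme is the scheme of a Frobenius group. In a Frobenius scheme all non-reflexive basis relations $s$ have the same valency $|\{\beta:(\alpha,\beta)\in s\}|$, called the valency $k$ of the scheme (it equals the order of a point stabilizer). -}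

module Defs where

open import Data.Nat using (ℕ; _≤_)
open import Data.Fin using (Fin; _≟_)
open import Data.List using (List; length; filter; allFin)
open import Data.Product using (Σ; ∃; ∃-syntax; _×_; _,_)
open import Function.Bundles using (_⤖_; _⇔_; Bijection)
open import Relation.Nullary using (¬_)
open import Relation.Nullary.Decidable using (_×-dec_)
open import Relation.Unary using (Pred; Decidable)
open import Relation.Binary.PropositionalEquality using (_≡_; _≢_)
open import Data.Fin.Permutation
  using (Permutation′; _⟨$⟩ʳ_; id; flip; _∘ₚ_; _≈_)
open import Level using (0ℓ)

count : ∀ {n} {P : Pred (Fin n) 0ℓ} → Decidable P → ℕ
count {n} P? = length (filter P? (allFin n))

-- A "coloring" of Ω × Ω, Ω = Fin n, into r classes Fin r.
-- Class s ∈ Fin r is the basis relation { (α , β) | c α β ≡ s }.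
Coloring : ℕ → ℕ → Set
Coloring n r = Fin n → Fin n → Fin r

inter : ∀ {n r} → Coloring n r → Fin r → Fin r → Fin n → Fin n → ℕ
inter {n} c s₁ s₂ α γ = count {n} (λ β → (c α β ≟ s₁) ×-dec (c β γ ≟ s₂))

record IsScheme {n r : ℕ} (c : Coloring n r) : Set where
  field
    -- every class is nonempty (S is a partition of Ω × Ω into r blocks)
    nonempty : ∀ (s : Fin r) → ∃[ α ] ∃[ β ] c α β ≡ s
    diag     : Fin r
    diag-def : ∀ α β → (c α β ≡ diag) ⇔ (α ≡ β)
    tr       : Fin r → Fin r
    tr-def   : ∀ s α β → (c α β ≡ s) ⇔ (c β α ≡ tr s)
    inter-const : ∀ s₁ s₂ α γ α′ γ′ → c α γ ≡ c α′ γ′ →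
                  inter c s₁ s₂ α γ ≡ inter c s₁ s₂ α′ γ′

-- rank of the scheme given by c : Coloring n r is r (the number of classes)

to : ∀ {a b} → Fin a ⤖ Fin b → Fin a → Fin b
to g = Bijection.to g

-- algebraic isomorphism: a bijection φ : S → S′ preserving all
-- intersection numbers c_{s₁ s₂}^t = c′_{φ s₁ φ s₂}^{φ t}
-- (c_{s₁ s₂}^t is computed at any (α , γ) ∈ t; classes are nonempty)
AlgIso : ∀ {n r n′ r′} → Coloring n r → Coloring n′ r′ → Set
AlgIso {n} {r} {n′} {r′} c c′ =
  Σ (Fin r ⤖ Fin r′) λ φ →
    ∀ s₁ s₂ α γ α′ γ′ → c′ α′ γ′ ≡ to φ (c α γ) →
      inter c s₁ s₂ α γ ≡ inter c′ (to φ s₁) (to φ s₂) α′ γ′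

SchemeIso : ∀ {n r n′ r′} → Coloring n r → Coloring n′ r′ → Set
SchemeIso {n} {r} {n′} {r′} c c′ =
  Σ (Fin n ⤖ Fin n′) λ f → Σ (Fin r ⤖ Fin r′) λ ψ →
    ∀ α β → c′ (to f α) (to f β) ≡ to ψ (c α β)

record IsPermGroup {n : ℕ} (G : Pred (Permutation′ n) 0ℓ) : Set where
  field
    resp    : ∀ {g h} → g ≈ h → G g → G h
    has-id  : G id
    closed-∘ : ∀ {g h} → G g → G h → G (g ∘ₚ h)
    closed-⁻¹ : ∀ {g} → G g → G (flip g)

record IsFrobeniusGroup {n : ℕ} (G : Pred (Permutation′ n) 0ℓ) : Set where
  field
    group      : IsPermGroup G
    transitive : ∀ α β → ∃[ g ] (G g × g ⟨$⟩ʳ α ≡ β)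
    nonregular : ∃[ g ] ∃[ α ] ∃[ β ] (G g × g ⟨$⟩ʳ α ≡ α × g ⟨$⟩ʳ β ≢ β)
    two-point  : ∀ g α β → G g → α ≢ β → g ⟨$⟩ʳ α ≡ α → g ⟨$⟩ʳ β ≡ β →
                 ∀ x → g ⟨$⟩ʳ x ≡ x

IsSchemeOf : ∀ {n r} → Pred (Permutation′ n) 0ℓ → Coloring n r → Set
IsSchemeOf G c = ∀ α β γ δ →
  (c α β ≡ c γ δ) ⇔ (∃[ g ] (G g × g ⟨$⟩ʳ α ≡ γ × g ⟨$⟩ʳ β ≡ δ))

IsFrobeniusScheme : ∀ {n r} → Coloring n r → Set₁
IsFrobeniusScheme {n} c =
  IsScheme c × Σ (Pred (Permutation′ n) 0ℓ) λ G → IsFrobeniusGroup G × IsSchemeOf G c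

HasValency : ∀ {n r} → (c : Coloring n r) → IsScheme c → ℕ → Set
HasValency {n} {r} c sch k =
  ∀ (s : Fin r) → s ≢ IsScheme.diag sch → ∀ α → count {n} (λ β → c α β ≟ s) ≡ k

{-# OPTIONS --safe #-}
-- Call points p₁, …, pₘ free when the only elements aᵢ of the point
-- stabilisers with a₁ a₂ ⋯ aₘ = 1 are aᵢ = 1.  A nontrivial element of a
-- Frobenius group fixes at most one point, so if p₁, …, pₘ are free then so
-- are p₁, …, pₘ, q for all but kᵐ points q; and freeness is invariant under
-- cyclic shifts.  If p, x, q, y are free, the colour of (x , y) is the only one
-- compatible with the colours of (p , x), (q , x), (p , y) and (q , y); this is
-- a statement about intersection numbers, so it passes to the algebraically
-- isomorphic scheme.  Hence any map e copying the colours to two base points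
-- α, β preserves the colour of almost every pair.  Copying the colours of x to a
-- generic pair p, q and its image under e moves each x to a point f x whose
-- colours to e z are right for almost all z, and a generic pair z, w then shows
-- that f preserves the colour of every pair.
module Submission where

open import Defs
open import Data.Fin using (Fin; zero; suc; _≟_)
open import Data.Fin.Permutation
  using (Permutation′; _⟨$⟩ʳ_; _⟨$⟩ˡ_; flip; _∘ₚ_; inverseˡ; inverseʳ)
open import Data.Fin.Properties using (any?; injective⇒≤)
open import Data.List using (List; []; _∷_; [_]; _++_; length; map; filter; allFin; lookup)
open import Data.List.Membership.Propositional using (_∈_; _∉_)
open import Data.List.Membership.Propositional.Properties
  using (∈-lookup; ∈-map⁻; ∈-filter⁺; ∈-filter⁻; ∈-allFin; ∈-++⁺ˡ; ∈-++⁺ʳ)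
open import Data.List.Properties using (length-++; length-map; length-tabulate)
open import Data.List.Relation.Unary.All.Properties using (¬Any⇒All¬)
open import Data.List.Relation.Unary.Any using (here; there; index)
open import Data.List.Relation.Unary.Any.Properties using (lookup-index)
open import Data.List.Relation.Unary.Unique.Propositional using (Unique; _∷_)
open import Data.List.Relation.Unary.Unique.Propositional.Properties
  using (allFin⁺; filter⁺; map⁺)
open import Data.Nat using (ℕ; suc; _+_; _*_; _≤_; _<_; z≤n; s≤s)
open import Data.Nat.Properties
  using (≤-refl; ≤-reflexive; ≤-trans; ≤-<-trans; +-mono-≤; m≤m+n; m≤n+m; n≮n)
open import Data.Product using (Σ; ∃; ∃-syntax; _×_; _,_; proj₁; proj₂)
open import Function.Bundles using (Bijection; Equivalence; mk⤖)
open import Function.Definitions using (Injective)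
open import Level using (0ℓ)
open import Relation.Binary.PropositionalEquality
  using (_≡_; _≢_; refl; sym; trans; cong; subst; ≢-sym)
open import Relation.Nullary using (yes; no; contradiction)
open import Relation.Nullary.Decidable using (¬?; decidable-stable)
open import Relation.Unary using (Pred; Decidable; _∩_)
import Data.List.Relation.Unary.All as All
import Data.List.Membership.DecPropositional as DecMembership

private
  variable
    n m B C : ℕ
    A : Set

-- Duplicate-free lists and counting.

lookup-injective : {xs : List A} → Unique xs → ∀ {i j} → lookup xs i ≡ lookup xs j → i ≡ j
lookup-injective (_ ∷ _)    {zero}  {zero}  _  = refl
lookup-injective (x∉ ∷ _)   {zero}  {suc j} eq = contradiction eq (All.lookup x∉ (∈-lookup j))
lookup-injective (x∉ ∷ _)   {suc i} {zero}  eq = contradiction (sym eq) (All.lookup x∉ (∈-lookup i))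
lookup-injective (_ ∷ uniq) {suc i} {suc j} eq = cong suc (lookup-injective uniq eq)

Unique-⊆⇒length≤ : {xs ys : List A} → Unique xs → (∀ {x} → x ∈ xs → x ∈ ys) →
                   length xs ≤ length ys
Unique-⊆⇒length≤ {xs = xs} {ys} uniq sub = injective⇒≤ {f = pos} λ {i} {j} eq →
  lookup-injective uniq
    (trans (lookup-pos i) (trans (cong (lookup ys) eq) (sym (lookup-pos j))))
  where
  pos : Fin (length xs) → Fin (length ys)
  pos i = index (sub (∈-lookup i))
  lookup-pos : ∀ i → lookup xs i ≡ lookup ys (pos i)
  lookup-pos i = lookup-index (sub (∈-lookup i))

-- A missed `y` could be put in front of `map f xs`, giving a duplicate-free list inside `ys` that
-- is longer than `ys`.
pigeonhole : {f : Fin n → Fin m} → Injective _≡_ _≡_ f →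
             {xs : List (Fin n)} {ys : List (Fin m)} → Unique xs →
             length xs ≡ length ys → (∀ {x} → x ∈ xs → f x ∈ ys) →
             ∀ {y} → y ∈ ys → ∃[ x ] f x ≡ y
pigeonhole {f = f} inj {xs} {ys} uniq len sub {y} y∈ys
  with y ∈? map f xs
  where open DecMembership _≟_
... | yes y∈ = let x , _ , eq = ∈-map⁻ f y∈ in x , sym eq
... | no  y∉ = contradiction
  (≤-trans (s≤s (≤-reflexive (trans (sym len) (sym (length-map f xs)))))
           (Unique-⊆⇒length≤ (¬Any⇒All¬ _ y∉ ∷ map⁺ inj uniq) ⊆ys))
  (n≮n _)
  where
  ⊆ys : ∀ {z} → z ∈ y ∷ map f xs → z ∈ ys
  ⊆ys (here refl) = y∈ys
  ⊆ys (there z∈)  = let x , x∈ , eq = ∈-map⁻ f z∈ in subst (_∈ ys) (sym eq) (sub x∈)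

-- Equal intersection numbers are used in this form: a triangle in one scheme yields a triangle with
-- corresponding colours in the other.
count-∃ : {P : Pred (Fin n) 0ℓ} {Q : Pred (Fin m) 0ℓ}
          (P? : Decidable P) (Q? : Decidable Q) →
          count P? ≡ count Q? → ∃ P → ∃ Q
count-∃ {n} {m} P? Q? eq (x , Px)
  with filter P? (allFin n) | ∈-filter⁺ P? (∈-allFin x) Px
     | filter Q? (allFin m) | (λ {y} → ∈-filter⁻ Q? {y} {allFin m})
count-∃ P? Q? () _ | _ ∷ _ | _ | []    | _
count-∃ P? Q? _  _ | _ ∷ _ | _ | y ∷ _ | Q⁻ = y , proj₂ (Q⁻ (here refl))

-- Properties of all but a bounded number of points.

Almost : ℕ → Pred (Fin n) 0ℓ → Set
Almost {n} B P = Σ (List (Fin n)) λ xs → length xs ≤ B × (∀ {x} → x ∉ xs → P x)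

module _ {P Q : Pred (Fin n) 0ℓ} where

  Almost-map : (∀ {x} → P x → Q x) → Almost B P → Almost B Q
  Almost-map f (xs , len , ok) = xs , len , λ x∉ → f (ok x∉)

  infixr 6 _∧_
  _∧_ : Almost B P → Almost C Q → Almost (B + C) (P ∩ Q)
  (xs , lx , P!) ∧ (ys , ly , Q!) =
    xs ++ ys
    , ≤-trans (≤-reflexive (length-++ xs)) (+-mono-≤ lx ly)
    , λ x∉ → P! (λ x∈ → x∉ (∈-++⁺ˡ x∈)) , Q! (λ x∈ → x∉ (∈-++⁺ʳ xs x∈))

Almost-All : {P : A → Pred (Fin n) 0ℓ} (ys : List A) →
             (∀ {y} → y ∈ ys → Almost B (P y)) →
             Almost (length ys * B) (λ x → ∀ {y} → y ∈ ys → P y x)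
Almost-All []       _ = [] , z≤n , λ _ ()
Almost-All (y ∷ ys) h =
  Almost-map (λ { (Py , _) (here refl) → Py ; (_ , Pys) (there y∈) → Pys y∈ })
             (h (here refl) ∧ Almost-All ys (λ y∈ → h (there y∈)))

Almost-≢ : (p : Fin n) → Almost 1 (_≢ p)
Almost-≢ p = [ p ] , ≤-refl , λ x∉ eq → x∉ (here eq)

Almost-∃ : {P : Pred (Fin n) 0ℓ} → Almost B P → B < n → ∃ P
Almost-∃ {n} (xs , len , ok) B<n with any? (λ x → ¬? (x ∈? xs))
  where open DecMembership _≟_
... | yes (x , x∉) = x , ok x∉
... | no  none     = contradiction
  (≤-<-trans (≤-trans all≤ len) B<n) (n≮n _)
  where
  open DecMembership _≟_ using (_∈?_)
  all≤ : n ≤ length xs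
  all≤ = ≤-trans (≤-reflexive (sym (length-tabulate {n = n} (λ x → x))))
    (Unique-⊆⇒length≤ (allFin⁺ n) λ {x} _ →
      decidable-stable (x ∈? xs) λ x∉ → none (x , x∉))

-- Trivial permutations and explicit bounds.

Trivial : Permutation′ n → Set
Trivial g = ∀ x → g ⟨$⟩ʳ x ≡ x

-- Bounds on the number of points that fail to extend two, respectively three,
-- free points, and on the number of points z for which the colour from f x to e z
-- may be wrong; choose-p, …, choose-w bound the points excluded when the generic
-- points p, q, z, w are chosen.
two three wrong : ℕ → ℕ
two   k = k * (k * 1)
three k = k * (k * (k * 1))
wrong k = three k + (three k + three k)

choose-p choose-q choose-z choose-w total threshold : ℕ → ℕ
choose-p k = two k + 1
choose-q k = two k + (three k + two k)
choose-z k = wrong k + (wrong k + (two k + two k))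
choose-w k = wrong k + (wrong k + (three k + three k))
total k = (choose-p k + choose-q k) + (choose-z k + choose-w k)
threshold k = suc (total k)

p≤ : ∀ k → choose-p k ≤ total k
p≤ k = ≤-trans (m≤m+n (choose-p k) (choose-q k)) (m≤m+n _ (choose-z k + choose-w k))

q≤ : ∀ k → choose-q k ≤ total k
q≤ k = ≤-trans (m≤n+m (choose-q k) (choose-p k)) (m≤m+n _ (choose-z k + choose-w k))

z≤ : ∀ k → choose-z k ≤ total k
z≤ k = ≤-trans (m≤m+n (choose-z k) (choose-w k)) (m≤n+m _ (choose-p k + choose-q k))

w≤ : ∀ k → choose-w k ≤ total k
w≤ k = ≤-trans (m≤n+m (choose-w k) (choose-z k)) (m≤n+m _ (choose-p k + choose-q k))

-- Colours as orbits of a Frobenius group.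

module FrobeniusScheme {n r k : ℕ} {c : Coloring n r} (frob : IsFrobeniusScheme c)
  (val : HasValency c (proj₁ frob) k) where

  open IsScheme (proj₁ frob)

  G : Pred (Permutation′ n) 0ℓ
  G = proj₁ (proj₂ frob)

  open IsFrobeniusGroup (proj₁ (proj₂ (proj₂ frob)))
  open IsPermGroup group

  c-invariant : ∀ {g x y} → G g → c x y ≡ c (g ⟨$⟩ʳ x) (g ⟨$⟩ʳ y)
  c-invariant Gg =
    Equivalence.from (proj₂ (proj₂ (proj₂ frob)) _ _ _ _) (_ , Gg , refl , refl)

  c-orbit : ∀ {x y u v} → c x y ≡ c u v →
            ∃[ g ] (G g × g ⟨$⟩ʳ x ≡ u × g ⟨$⟩ʳ y ≡ v)
  c-orbit = Equivalence.to (proj₂ (proj₂ (proj₂ frob)) _ _ _ _)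

  neighbour : ∀ x s → ∃[ y ] c x y ≡ s
  neighbour x s =
    let u , v , cuv   = nonempty s
        g , Gg , gu≡x = transitive u x
    in  g ⟨$⟩ʳ v , trans (cong (λ b → c b (g ⟨$⟩ʳ v)) (sym gu≡x))
                         (trans (sym (c-invariant Gg)) cuv)

  -- Turns the bound on the rank into the bound on the number of points that generic choices need:
  -- neighbours of `x` in distinct colours are distinct.
  rank≤degree : Fin n → r ≤ n
  rank≤degree x = injective⇒≤ {f = λ s → proj₁ (neighbour x s)} λ {s} {t} eq →
    trans (sym (proj₂ (neighbour x s))) (trans (cong (c x) eq) (proj₂ (neighbour x t)))

  distinct-points : ∃[ α ] ∃[ β ] α ≢ β
  distinct-points =
    let g , α , β , _ , gα≡α , gβ≢β = nonregular
    in  α , β , λ { refl → gβ≢β gα≡α }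

  another : ∀ p → ∃[ q ] q ≢ p
  another p with distinct-points
  ... | α , β , α≢β with α ≟ p
  ...   | no  α≢p  = α , α≢p
  ...   | yes refl = β , ≢-sym α≢β

  -- Point stabilisers and free points.

  Stab : Fin n → Pred (Permutation′ n) 0ℓ
  Stab p g = G g × g ⟨$⟩ʳ p ≡ p

  Stab-two-point : ∀ {p q g} → p ≢ q → Stab p g → g ⟨$⟩ʳ q ≡ q → Trivial g
  Stab-two-point p≢q (Gg , gp) gq = two-point _ _ _ Gg p≢q gp gq

  -- `g` followed by the inverse of `h` fixes both `p` and `q`, so it is trivial.
  Stab-agree : ∀ {p q g h} → q ≢ p → Stab p g → Stab p h →
               g ⟨$⟩ʳ q ≡ h ⟨$⟩ʳ q → ∀ x → g ⟨$⟩ʳ x ≡ h ⟨$⟩ʳ x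
  Stab-agree {g = g} {h} q≢p (Gg , gp) (Gh , hp) gq≡hq x =
    trans (sym (inverseʳ h)) (cong (h ⟨$⟩ʳ_)
      (Stab-two-point (≢-sym q≢p)
        (closed-∘ Gg (closed-⁻¹ Gh) , back (trans gp (sym hp))) (back gq≡hq) x))
    where
    back : ∀ {y} → g ⟨$⟩ʳ y ≡ h ⟨$⟩ʳ y → h ⟨$⟩ˡ (g ⟨$⟩ʳ y) ≡ y
    back eq = trans (cong (h ⟨$⟩ˡ_) eq) (inverseˡ h)

  Almost-moved : ∀ {g} → G g → Almost 1 (λ x → g ⟨$⟩ʳ x ≡ x → Trivial g)
  Almost-moved {g} Gg with any? (λ x → g ⟨$⟩ʳ x ≟ x)
  ... | no  none       = [] , z≤n , λ _ gx≡x → contradiction (_ , gx≡x) none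
  ... | yes (y , gy≡y) = [ y ] , ≤-refl , λ x∉ gx≡x →
    Stab-two-point (λ y≡x → x∉ (here (sym y≡x))) (Gg , gy≡y) gx≡x

  -- A stabiliser acts faithfully on each of its nontrivial orbits, which have
  -- k points.
  Almost-Stab : ∀ p {P : Permutation′ n → Pred (Fin n) 0ℓ} →
    (∀ {g h x} → (∀ y → g ⟨$⟩ʳ y ≡ h ⟨$⟩ʳ y) → P g x → P h x) →
    (∀ {g} → Stab p g → Almost B (P g)) →
    Almost (k * B) (λ x → ∀ {g} → Stab p g → P g x)
  Almost-Stab {B} p {P} resp-P almost =
    subst (λ l → Almost (l * B) (λ x → ∀ {g} → Stab p g → P g x)) orbit-length
      (Almost-map
        (λ h {g} g∈ → h (∈-filter⁺ orbit? (∈-allFin (g ⟨$⟩ʳ q)) (moved g∈)) g g∈ refl)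
        (Almost-All {P = λ y x → ∀ g → Stab p g → g ⟨$⟩ʳ q ≡ y → P g x} orbit
          λ y∈ → above (sym (proj₂ (∈-filter⁻ orbit? {xs = allFin n} y∈)))))
    where
    -- `Stab p` is only a predicate, so its elements are indexed by their images of one point `q`;
    -- those with the same image agree everywhere.
    q   = proj₁ (another p)
    q≢p = proj₂ (another p)
    orbit? : Decidable (λ y → c p y ≡ c p q)
    orbit? y = c p y ≟ c p q
    orbit : List (Fin n)
    orbit = filter orbit? (allFin n)
    orbit-length : length orbit ≡ k
    orbit-length = val (c p q)
      (λ eq → q≢p (sym (Equivalence.to (diag-def p q) eq))) p
    above : ∀ {y} → c p q ≡ c p y →
            Almost B (λ x → ∀ g → Stab p g → g ⟨$⟩ʳ q ≡ y → P g x)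
    above eq with c-orbit eq
    ... | g , Gg , gp , gq = Almost-map
      (λ Pgx h h∈ hq → resp-P {g} {h} (Stab-agree {g = g} {h} q≢p (Gg , gp) h∈ (trans gq (sym hq))) Pgx)
      (almost (Gg , gp))
    moved : ∀ {g} → Stab p g → c p (g ⟨$⟩ʳ q) ≡ c p q
    moved {g} (Gg , gp) =
      trans (cong (λ u → c u (g ⟨$⟩ʳ q)) (sym gp)) (sym (c-invariant Gg))

  -- The factor from the stabiliser of the last point is eliminated: it is the
  -- inverse of the product of the others, which must therefore fix that point.
  Free₃ : Fin n → Fin n → Fin n → Set
  Free₃ p q s = ∀ {a b} → Stab p a → Stab q b →
    a ⟨$⟩ʳ (b ⟨$⟩ʳ s) ≡ s → Trivial a × Trivial b

  Free₄ : Fin n → Fin n → Fin n → Fin n → Set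
  Free₄ p q s t = ∀ {a b d} → Stab p a → Stab q b → Stab s d →
    a ⟨$⟩ʳ (b ⟨$⟩ʳ (d ⟨$⟩ʳ t)) ≡ t → Trivial a × Trivial b × Trivial d

  Stab-⁻¹ : ∀ {p g} → Stab p g → Stab p (flip g)
  Stab-⁻¹ {g = g} (Gg , gp) = closed-⁻¹ Gg , trans (cong (g ⟨$⟩ˡ_) (sym gp)) (inverseˡ g)

  Trivial-⁻¹ : ∀ {g : Permutation′ n} → Trivial (flip g) → Trivial g
  Trivial-⁻¹ {g} T x = trans (cong (g ⟨$⟩ʳ_) (sym (T x))) (inverseʳ g)

  -- The product `w` of the two given elements lies in `Stab p`, and `b` followed by the inverse of
  -- `w` is the inverse of `d`, which fixes `s`; so `free` applies.
  Free₃-rotate : ∀ {p q s} → Free₃ p q s → Free₃ q s p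
  Free₃-rotate {s = s} free {b} {d} b∈@(Gb , _) (Gd , ds) fix =
    let Tw , Tb = free {flip w} {b} (Stab-⁻¹ (closed-∘ Gd Gb , fix)) b∈
                    (trans (cong (λ y → w ⟨$⟩ˡ (b ⟨$⟩ʳ y)) (sym ds)) (inverseˡ w))
    in  Tb , λ x → trans (sym (Tb _)) (Trivial-⁻¹ {w} Tw x)
    where w = d ∘ₚ b

  Free₄-rotate : ∀ {p q s t} → Free₄ p q s t → Free₄ q s t p
  Free₄-rotate free {b} {d} {e} b∈@(Gb , _) d∈@(Gd , _) (Ge , et) fix =
    let Tw , Tb , Td = free {flip w} {b} {d}
          (Stab-⁻¹ (closed-∘ Ge (closed-∘ Gd Gb) , fix)) b∈ d∈
          (trans (cong (λ y → w ⟨$⟩ˡ (b ⟨$⟩ʳ (d ⟨$⟩ʳ y))) (sym et)) (inverseˡ w))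
    in  Tb , Td , λ x → trans (sym (Td _)) (trans (sym (Tb _)) (Trivial-⁻¹ {w} Tw x))
    where w = e ∘ₚ d ∘ₚ b

  -- Each nontrivial product of an element of `Stab p` and one of `Stab q` rules out at most its one
  -- fixed point. If the product is trivial, `a` fixes `q` as well as `p`.
  Almost-Free₃ : ∀ {p q} → p ≢ q → Almost (two k) (Free₃ p q)
  Almost-Free₃ {p} {q} p≢q = Almost-map
    (λ h {a} {b} a∈ b∈ fix →
      let ab = h a∈ b∈ fix
          Ta = Stab-two-point p≢q a∈
                 (trans (cong (a ⟨$⟩ʳ_) (sym (proj₂ b∈))) (ab q))
      in  Ta , λ x → trans (sym (Ta _)) (ab x))
    (Almost-Stab p
      {λ a x → ∀ {b} → Stab q b → a ⟨$⟩ʳ (b ⟨$⟩ʳ x) ≡ x → Trivial (b ∘ₚ a)}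
      (λ eq h b∈ fix y → trans (sym (eq _)) (h b∈ (trans (eq _) fix) y))
      λ {a} a∈ → Almost-Stab q
      {λ b x → a ⟨$⟩ʳ (b ⟨$⟩ʳ x) ≡ x → Trivial (b ∘ₚ a)}
      (λ eq h fix y → trans (cong (a ⟨$⟩ʳ_) (sym (eq _)))
                        (h (trans (cong (a ⟨$⟩ʳ_) (eq _)) fix) y))
      λ b∈ → Almost-moved (closed-∘ (proj₁ b∈) (proj₁ a∈)))

  Almost-Free₄ : ∀ {p q s} → Free₃ p q s → Almost (three k) (Free₄ p q s)
  Almost-Free₄ {p} {q} {s} free = Almost-map
    (λ h {a} {b} {d} a∈ b∈ d∈ fix →
      let abd = h a∈ b∈ d∈ fix
          -- Since `d` and the whole product fix `s`, so does `b` followed by `a`.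
          Ta , Tb = free a∈ b∈
            (trans (cong (λ y → a ⟨$⟩ʳ (b ⟨$⟩ʳ y)) (sym (proj₂ d∈))) (abd s))
      in  Ta , Tb , λ x → trans (sym (Tb _)) (trans (sym (Ta _)) (abd x)))
    (Almost-Stab p
      {λ a x → ∀ {b} → Stab q b → ∀ {d} → Stab s d →
         a ⟨$⟩ʳ (b ⟨$⟩ʳ (d ⟨$⟩ʳ x)) ≡ x → Trivial (d ∘ₚ b ∘ₚ a)}
      (λ eq h b∈ d∈ fix y → trans (sym (eq _)) (h b∈ d∈ (trans (eq _) fix) y))
      λ {a} a∈ → Almost-Stab q
      {λ b x → ∀ {d} → Stab s d →
         a ⟨$⟩ʳ (b ⟨$⟩ʳ (d ⟨$⟩ʳ x)) ≡ x → Trivial (d ∘ₚ b ∘ₚ a)}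
      (λ eq h d∈ fix y → trans (cong (a ⟨$⟩ʳ_) (sym (eq _)))
                           (h d∈ (trans (cong (a ⟨$⟩ʳ_) (eq _)) fix) y))
      λ {b} b∈ → Almost-Stab s
      {λ d x → a ⟨$⟩ʳ (b ⟨$⟩ʳ (d ⟨$⟩ʳ x)) ≡ x → Trivial (d ∘ₚ b ∘ₚ a)}
      (λ eq h fix y → trans (cong (λ z → a ⟨$⟩ʳ (b ⟨$⟩ʳ z)) (sym (eq _)))
                        (h (trans (cong (λ z → a ⟨$⟩ʳ (b ⟨$⟩ʳ z)) (eq _)) fix) y))
      λ d∈ → Almost-moved (closed-∘ (proj₁ d∈) (closed-∘ (proj₁ b∈) (proj₁ a∈))))

  -- Transfer along the algebraic isomorphism.

  module AlgebraicIsomorphism {n′ r′ : ℕ} {c′ : Coloring n′ r′} (sch′ : IsScheme c′)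
    (iso : AlgIso c c′) (threshold≤n : threshold k ≤ n) where

    open IsScheme sch′ using ()
      renaming (diag to diag′; diag-def to diag-def′; tr-def to tr-def′)

    φ : Fin r → Fin r′
    φ = to (proj₁ iso)

    φ-injective : Injective _≡_ _≡_ φ
    φ-injective = Bijection.injective (proj₁ iso)

    φ-surjective : ∀ s′ → ∃[ s ] φ s ≡ s′
    φ-surjective = Bijection.strictlySurjective (proj₁ iso)

    infix 4 _-_∼_-_
    _-_∼_-_ : Fin n → Fin n → Fin n′ → Fin n′ → Set
    x - y ∼ x′ - y′ = c′ x′ y′ ≡ φ (c x y)

    push : ∀ {x z x′ z′} → x - z ∼ x′ - z′ →
           ∀ y → ∃[ y′ ] (x - y ∼ x′ - y′ × y - z ∼ y′ - z′)
    push eq y = count-∃ _ _ (proj₂ iso _ _ _ _ _ _ eq) (y , refl , refl)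

    pull : ∀ {x z x′ z′} → x - z ∼ x′ - z′ → ∀ {s t} y′ →
           c′ x′ y′ ≡ φ s → c′ y′ z′ ≡ φ t → ∃[ y ] (c x y ≡ s × c y z ≡ t)
    pull eq y′ xy yz =
      count-∃ _ _ (sym (proj₂ iso _ _ _ _ _ _ eq)) (y′ , xy , yz)

    -- Take `u`, `v` whose colour maps to `diag′` and copy the triangle `u`, `u`, `v`. The copy `y′`
    -- of its middle point has colour `diag′` to `x′`, so it is `x′`, and the colour of `u`, `u`
    -- maps to `diag′`.
    ∼-refl : ∀ x x′ → x - x ∼ x′ - x′
    ∼-refl x x′ =
      let t , φt         = φ-surjective (c′ x′ x′)
          u , v , cuv    = nonempty t
          uv             = trans (sym φt) (cong φ (sym cuv))
          y′ , uu , y′x′ = push uv u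
          y′≡x′          = Equivalence.to (diag-def′ y′ x′)
                             (trans y′x′ (trans (sym uv) (c-refl′ x′)))
      in  trans (cong (c′ x′) (sym y′≡x′)) (trans uu (cong φ (trans (c-refl u) (sym (c-refl x)))))
      where
      c-refl : ∀ y → c y y ≡ diag
      c-refl y = Equivalence.from (diag-def y y) refl
      c-refl′ : ∀ y → c′ y y ≡ diag′
      c-refl′ y = Equivalence.from (diag-def′ y y) refl

    -- Copying the degenerate triangle `x`, `y`, `x` gives a `z′` with both colours right; the
    -- transpose in `c′` depends only on the colour, so `y′` behaves like `z′`.
    ∼-swap : ∀ {x y x′ y′} → x - y ∼ x′ - y′ → y - x ∼ y′ - x′
    ∼-swap {x} {y} {x′} {y′} xy =
      let z′ , xz , zx = push (∼-refl x x′) y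
          z′x′ = Equivalence.to (tr-def′ _ x′ z′) refl
          y′x′ = Equivalence.to (tr-def′ _ x′ y′) (trans xy (sym xz))
      in  trans y′x′ (trans (sym z′x′) zx)

    -- Let `b` be the colour that the pair `x′`, `y′` reflects. Some `y₁` and `y₂` have colour `b`
    -- from `x` and look like `y` from `p` and from `q` respectively. Stabilisers of `q`, `x`, `p`
    -- lead from `y` to `y₂`, to `y₁` and back to `y`, so freeness forces `y₂ ≡ y`.
    ∼-determined : ∀ {p q x y p′ q′ x′ y′} → Free₄ p x q y →
      p - x ∼ p′ - x′ → q - x ∼ q′ - x′ → p - y ∼ p′ - y′ → q - y ∼ q′ - y′ →
      x - y ∼ x′ - y′
    ∼-determined {p} {q} {x} {y} {p′} {q′} {x′} {y′} free px qx py qy =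
      let b , φb               = φ-surjective (c′ x′ y′)
          u , v , cuv          = nonempty b
          uv                   = trans (sym φb) (cong φ (sym cuv))
          y₁ , xy₁ , py₁       = candidate uv p′ px py
          y₂ , xy₂ , qy₂       = candidate uv q′ qx qy
          a , Ga , ap , ay₁    = c-orbit py₁
          d , Gd , dx , dy₂    = c-orbit (trans xy₂ (sym xy₁))
          g , Gg , gq , gy     = c-orbit (sym qy₂)
          _ , _ , Tg           = free {a} {d} {g} (Ga , ap) (Gd , dx) (Gg , gq)
            (trans (cong (λ z → a ⟨$⟩ʳ (d ⟨$⟩ʳ z)) gy) (trans (cong (a ⟨$⟩ʳ_) dy₂) ay₁))
          y₂≡y                 = trans (sym gy) (Tg y)
      in  trans uv (cong φ (trans (sym xy₂) (cong (c x) y₂≡y)))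
      where
      candidate : ∀ {u v z} → u - v ∼ x′ - y′ → ∀ z′ →
        z - x ∼ z′ - x′ → z - y ∼ z′ - y′ → ∃[ w ] (c x w ≡ c u v × c z w ≡ c z y)
      candidate {v = v} uv z′ zx zy =
        -- The triangle through `z′` is pulled back to one on `u`, `v`, and the group moves its side
        -- `u`, `z₀` onto `x`, `z`.
        let z₀ , uz₀ , z₀v    = pull uv z′ (∼-swap zx) zy
            g , Gg , gu , gz₀ = c-orbit uz₀
            gv                = g ⟨$⟩ʳ v
        in  gv , trans (cong (λ w → c w gv) (sym gu)) (sym (c-invariant Gg))
               , trans (cong (λ w → c w gv) (sym gz₀)) (trans (sym (c-invariant Gg)) z₀v)

    abstract
      copy : ∀ {p q p′ q′} → p - q ∼ p′ - q′ →
             ∀ x → ∃[ x′ ] (p - x ∼ p′ - x′ × q - x ∼ q′ - x′)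
      copy pq x = let x′ , px , xq = push pq x in x′ , px , ∼-swap xq

      generic : {P : Pred (Fin n) 0ℓ} → B ≤ total k → Almost B P → ∃ P
      generic B≤ almost = Almost-∃ almost (≤-trans (s≤s B≤) threshold≤n)

    -- Construction of the isomorphism.

    module Extension {α β : Fin n} (α≢β : α ≢ β) {α′ β′ : Fin n′}
      (αβ : α - β ∼ α′ - β′) where

      e : Fin n → Fin n′
      e x = proj₁ (copy αβ x)

      e-correct : ∀ {x y} → Free₄ α x β y → x - y ∼ e x - e y
      e-correct {x} {y} free =
        let _ , αx , βx = copy αβ x
            _ , αy , βy = copy αβ y
        in  ∼-determined free αx βx αy βy

      Almost-Free₃-αβ : Almost (two k) (λ x → Free₃ α x β)
      Almost-Free₃-αβ = Almost-map Free₃-rotate (Almost-Free₃ (≢-sym α≢β))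

      abstract
        -- Corrects `e`, whose colours are controlled only at points free with `α` and `β`: an
        -- arbitrary `x` is placed relative to `p` and `q`, where `e` is reliable.
        image : ∀ x → ∃[ x′ ] Almost (wrong k) (λ z → x - z ∼ x′ - e z)
        image x =
          let p , αpβ , p≢x        = generic (p≤ k) (Almost-Free₃-αβ ∧ Almost-≢ x)
              q , αqβ , αpβq , pxq = generic (q≤ k)
                (Almost-Free₃-αβ ∧ Almost-Free₄ αpβ ∧ Almost-Free₃ p≢x)
              x′ , px , qx         = copy (e-correct αpβq) x
          in  x′ , Almost-map
                (λ (pxqz , αpβz , αqβz) →
                  ∼-determined pxqz px qx (e-correct αpβz) (e-correct αqβz))
                (Almost-Free₄ pxq ∧ Almost-Free₄ αpβ ∧ Almost-Free₄ αqβ)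

      f : Fin n → Fin n′
      f x = proj₁ (image x)

      f-correct : ∀ x y → x - y ∼ f x - f y
      f-correct x y with x ≟ y
      ... | yes refl = ∼-refl x (f x)
      ... | no  x≢y =
        let z , xz , yz , αzβ , xyz = generic (z≤ k)
              (proj₂ (image x) ∧ proj₂ (image y) ∧ Almost-Free₃-αβ ∧ Almost-Free₃ x≢y)
            w , xw , yw , αzβw , yzxw = generic (w≤ k)
              (proj₂ (image x) ∧ proj₂ (image y) ∧ Almost-Free₄ αzβ
                ∧ Almost-Free₄ (Free₃-rotate xyz))
        -- After rotation the order is `z`, `x`, `w`, `y`, so `z` and `w` serve as the reference
        -- points.
        in  ∼-determined (Free₄-rotate yzxw)
              (∼-swap xz) (∼-swap xw) (∼-swap yz) (∼-swap yw)

      f-injective : Injective _≡_ _≡_ f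
      f-injective {x} {y} fx≡fy = Equivalence.to (diag-def x y) (trans
        (φ-injective (trans (sym (f-correct x y))
          (trans (cong (c′ (f x)) (sym fx≡fy)) (∼-refl x (f x)))))
        (Equivalence.from (diag-def x x) refl))

      -- Argued one colour at a time around `α`: a valency is an intersection number at a diagonal
      -- pair, so corresponding neighbourhoods of `α` and `f α` have equal size and the injective
      -- `f` fills the second.
      f-surjective : ∀ y′ → ∃[ x ] f x ≡ y′
      f-surjective y′ =
        let s , φs = φ-surjective (c′ (f α) y′)
            y , αy = neighbour α s
            αy∼    = trans (sym φs) (cong φ (sym αy))
        in  pigeonhole f-injective
              (filter⁺ _ (allFin⁺ n))
              (proj₂ iso (c α y) (c y α) α α (f α) (f α) (∼-refl α (f α)))
              (λ {x} x∈ →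
                let _ , αx , xα = ∈-filter⁻ _ {xs = allFin n} x∈
                in  ∈-filter⁺ _ (∈-allFin (f x))
                      (trans (f-correct α x) (cong φ αx) , trans (f-correct x α) (cong φ xα)))
              (∈-filter⁺ _ (∈-allFin y′) (αy∼ , ∼-swap αy∼))

    isomorphism : SchemeIso c c′
    isomorphism =
      let α , β , α≢β  = distinct-points
          _ , _ , αβ   = IsScheme.nonempty sch′ (φ (c α β))
          open Extension α≢β αβ
      in  mk⤖ (f-injective , λ y′ → let x , fx = f-surjective y′ in x , λ { refl → fx })
          , proj₁ iso , f-correct

theorem1p3 : Σ (ℕ → ℕ) λ f →
    ∀ {n r : ℕ} (c : Coloring n r) (frob : IsFrobeniusScheme c) (k : ℕ) →
    HasValency c (proj₁ frob) k →
    f k ≤ r →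
    ∀ {n′ r′ : ℕ} (c′ : Coloring n′ r′) → IsScheme c′ →
    AlgIso c c′ → SchemeIso c c′
theorem1p3 = threshold , λ c frob k val f≤r c′ sch′ iso →
  let open FrobeniusScheme frob val
      open AlgebraicIsomorphism sch′ iso
        (≤-trans f≤r (rank≤degree (proj₁ distinct-points)))
  in  isomorphism
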